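{- Consider an instance of Restricted Assignment with $n$ jobs and $m$ machines, a (possibly infeasible) predicted assignment $\hat\pi:[n]\to[m]$, and a threshold $T$. Assume that $T\ge \mathrm{OPT}$ and $\Delta(T)>0$. Then the algorithm GlobalRepair$(T,\hat\pi)$ returns a feasible schedule $\sigma$ with $C_{\max}(\sigma)\le T$ in time $$\widetilde{O}\!\left(n\cdot m^{O(\mathcal{E})}\cdot \mathcal{E}^{O(\mathcal{E})}\right),$$ where $\widetilde{O}(\cdot)$ hides logarithmic factors.
   Context: Restricted Assignment: there are $n$ jobs and $m$ machines. Each job $j\in[n]$ has an integer processing time $p_j\in\mathbb{Z}_{\ge 1}$ and a nonempty set $\Gamma(j)\subseteq[m]$ of eligible machines. A schedule $\sigma:[n]\to[m]$ is feasible if $\sigma(j)\in\Gamma(j)$ for all $j$. Write $L_i(\sigma)=\sum_{j:\sigma(j)=i}p_j$, $C_{\max}(\sigma)=\max_{i\in[m]}L_i(\sigma)$, and $\mathrm{OPT}=\min\{C_{\max}(\sigma):\sigma\text{ feasible}\}$. For a feasible schedule $\sigma$ and any map $\tau:[n]\to[m]$, $\mathrm{move}(\sigma,\tau)=\sum_{j:\sigma(j)\ne\tau(j)}p_j$. The prediction error is $\mathcal{E}=\min\{\mathrm{move}(\sigma^*,\hat\pi):\sigma^*\text{ feasible and }C_{\max}(\sigma^*)=\mathrm{OPT}\}$; it is not known to the algorithm. $\mathsf{Project}(\hat\pi)$: process the jobs one by one in a fixed arbitrary order; if $\hat\pi(j)\in\Gamma(j)$, set $\hat\sigma(j)=\hat\pi(j)$;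 otherwise assign $j$ to a currently least-loaded machine of $\Gamma(j)$ (ties arbitrary). Let $\hat\sigma=\mathsf{Project}(\hat\pi)$, $\hat L_i=L_i(\hat\sigma)$, $O(T)=\{i\in[m]:\hat L_i>T\}$, and $\Delta(T)=\sum_{i\in[m]}\max\{\hat L_i-T,0\}$. Fixed-set procedure: for an integer $K\ge1$ and a nonempty $A\subseteq[m]$ with $O(T)\subseteq A$, let $J_A=\{j:\hat\sigma(j)\in A\}$. There is a dynamic program running in time $O(|J_A|\cdot|A|\cdot(2K+1)^{|A|-1})$ that outputs a feasible schedule $\sigma$ with (1) $\sigma(j)=\hat\sigma(j)$ for $j\notin J_A$; (2) $\sigma(j)\in\Gamma(j)\cap A$ for $j\in J_A$; (3) $\mathrm{move}(\sigma,\hat\sigma)\le K$; (4) $C_{\max}(\sigma)\le T$, if one exists, and outputs Fail otherwise. GlobalRepairOracle$(T,K,\hat\sigma)$: enumerate all sets $A\subseteq[m]$ with $O(T)\subseteq A$ and $|A|\le 2K$, run the fixed-set procedure for each, and return the first schedule found, or Fail if none is found (if $|O(T)|>2K$ return Fail immediately). GlobalRepair$(T,\hat\pi)$: compute $\hat\sigma=\mathsf{Project}(\hat\pi)$ and $\Delta(T)$. If $\Delta(T)=0$, return $\hat\sigma$. Otherwise set $K=\lceil\Delta(T)\rceil$ and repeat: call GlobalRepairOracle$(T,K,\hat\sigma)$; if it returns a schedule, return it; otherwise set $K\leftarrow 2K$. -}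

module Defs where

open import Data.Bool.Base using (if_then_else_)
open import Data.Fin.Base using (Fin)
import Data.Fin.Properties as Fin
open import Data.Fin.Subset using (Subset; _∈_; _⊆_; Nonempty; ∣_∣)
open import Data.Fin.Subset.Properties using (_∈?_)
open import Data.Integer.Base as ℤ using (+_)
open import Data.List.Base using (List; []; _∷_; allFin)
import Data.List.Base as List
open import Data.List.Extrema.Nat using (max)
import Data.List.Membership.Propositional as List using (_∈_)
open import Data.List.Relation.Binary.Permutation.Propositional using (_↭_)
open import Data.List.Relation.Unary.Unique.Propositional using (Unique)
open import Data.Maybe.Base using (Maybe; just; nothing)
open import Data.Nat.Base using (ℕ; _+_; _*_; _∸_; _^_; _≤_)
import Data.Nat.Properties as ℕ
open import Data.Product.Base using (∃-syntax; _×_; _,_)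
open import Data.Rational.Base as ℚ using (ℚ; 0ℚ; _/_; ceiling)
import Data.Rational.Properties as ℚ
open import Data.Unit.Base using (⊤; tt)
open import Data.Vec.Base using (tabulate)
open import Data.Vec.Functional using (updateAt)
open import Function.Base using (const)
open import Function.Bundles using (_⇔_)
open import Relation.Binary.PropositionalEquality using (_≡_; _≢_)
open import Relation.Nullary.Decidable.Core using (does)
open import Relation.Nullary.Negation.Core using (¬_)

open import Algebra.Properties.CommutativeMonoid.Sum ℕ.+-0-commutativeMonoid
  using () renaming (sum to sumℕ)
open import Algebra.Properties.CommutativeMonoid.Sum ℚ.+-0-commutativeMonoid
  using () renaming (sum to sumℚ)

toℚ : ℕ → ℚ
toℚ k = + k / 1

-- v is the minimum of f over all x satisfying P.
IsMinimum : {A : Set} → (A → Set) → (A → ℕ) → ℕ → Set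
IsMinimum {A} P f v = (∃[ x ] P x × f x ≡ v) × (∀ (x : A) → P x → v ≤ f x)

------------------------------------------------------------------------
-- Restricted Assignment

record Instance (n m : ℕ) : Set where
  field
    p          : Fin n → ℕ
    p≥1        : ∀ j → 1 ≤ p j
    Γ          : Fin n → Subset m
    Γ-nonempty : ∀ j → Nonempty (Γ j)

Schedule : ℕ → ℕ → Set
Schedule n m = Fin n → Fin m

module _ {n m : ℕ} (I : Instance n m) where
  open Instance I

  Feasible : Schedule n m → Set
  Feasible σ = ∀ j → σ j ∈ Γ j

  load : Schedule n m → Fin m → ℕ
  load σ i = sumℕ λ j → if does (σ j Fin.≟ i) then p j else 0

  Cmax : Schedule n m → ℕ
  Cmax σ = max 0 (List.tabulate (load σ))

  IsOPT : ℕ → Set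
  IsOPT = IsMinimum Feasible Cmax

  move : Schedule n m → Schedule n m → ℕ
  move σ τ = sumℕ λ j → if does (σ j Fin.≟ τ j) then 0 else p j

  IsError : Schedule n m → ℕ → Set
  IsError π̂ =
    IsMinimum (λ σ* → Feasible σ* × IsOPT (Cmax σ*)) (λ σ* → move σ* π̂)

  overloaded : Schedule n m → ℚ → Subset m
  overloaded σ T = tabulate λ i → does (T ℚ.<? toℚ (load σ i))

  Δ : Schedule n m → ℚ → ℚ
  Δ σ T = sumℚ λ i → (toℚ (load σ i) ℚ.- T) ℚ.⊔ 0ℚ

  jobsOn : Schedule n m → Subset m → Subset n
  jobsOn σ A = tabulate λ j → does (σ j ∈? A)

  record IsRepair (σ̂ : Schedule n m) (T : ℚ) (K : ℕ) (A : Subset m)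
                  (σ : Schedule n m) : Set where
    field
      feasible    : Feasible σ
      fixed-off-A : ∀ j → ¬ (σ̂ j ∈ A) → σ j ≡ σ̂ j
      stays-in-A  : ∀ j → σ̂ j ∈ A → σ j ∈ Γ j × σ j ∈ A
      move≤K      : move σ σ̂ ≤ K
      Cmax≤T      : toℚ (Cmax σ) ℚ.≤ T

------------------------------------------------------------------------
-- Running time is the number of elementary steps.  Numbers are handled in
-- unit cost.

infix 3 _costs_

record Timed (A : Set) : Set where
  constructor _costs_
  field
    result : A
    time   : ℕ

open Timed public

return : {A : Set} → A → Timed A
return x = x costs 0

infixl 1 _>>=_ _>>_

_>>=_ : {A B : Set} → Timed A → (A → Timed B) → Timed B
(x costs s) >>= f = result (f x) costs (s + time (f x))

_>>_ : {A B : Set} → Timed A → Timed B → Timed B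
a >> b = a >>= const b

tick : ℕ → Timed ⊤
tick k = tt costs k

-- The fixed-set dynamic program is used only through its specification and its
-- time bound.  The constant κ is uniform over all instances.
record FixedSetProcedure : Set where
  field
    run : ∀ {n m} → Instance n m → (σ̂ : Schedule n m) (T : ℚ) (K : ℕ)
          (A : Subset m) → Timed (Maybe (Schedule n m))
    κ   : ℕ

  Admissible : ∀ {n m} → Instance n m → Schedule n m → ℚ → ℕ → Subset m → Set
  Admissible I σ̂ T K A =
    Feasible I σ̂ × 1 ≤ K × Nonempty A × overloaded I σ̂ T ⊆ A

  field
    sound : ∀ {n m} (I : Instance n m) σ̂ T K A {σ} → Admissible I σ̂ T K A →
            result (run I σ̂ T K A) ≡ just σ → IsRepair I σ̂ T K A σ
    complete : ∀ {n m} (I : Instance n m) σ̂ T K A → Admissible I σ̂ T K A →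
               result (run I σ̂ T K A) ≡ nothing →
               ¬ (∃[ σ ] IsRepair I σ̂ T K A σ)
    time-bound : ∀ {n m} (I : Instance n m) σ̂ T K A → Admissible I σ̂ T K A →
                 time (run I σ̂ T K A) ≤
                 κ * (∣ jobsOn I σ̂ A ∣ * ∣ A ∣ * (2 * K + 1) ^ (∣ A ∣ ∸ 1))

------------------------------------------------------------------------
-- The algorithm

-- Everything the algorithm leaves open: the order in which Project handles the
-- jobs, its tie-breaking (which may depend on the job, hence on the stage of
-- the run), and the order in which the oracle enumerates machine sets.
record Choices {n m : ℕ} (I : Instance n m) : Set where
  open Instance I
  field
    order       : List (Fin n)
    order-↭     : order ↭ allFin n
    least       : Fin n → (Fin m → ℕ) → Fin m
    least-∈     : ∀ j ℓ → least j ℓ ∈ Γ j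
    least-≤     : ∀ j (ℓ : Fin m → ℕ) i → i ∈ Γ j → ℓ (least j ℓ) ≤ ℓ i
    supersets   : Subset m → ℕ → List (Subset m)
    supersets-∈ : ∀ O k A → A List.∈ supersets O k ⇔ (O ⊆ A × ∣ A ∣ ≤ k)
    supersets-! : ∀ O k → Unique (supersets O k)

-- "Repeat: call f K; if it succeeds, return the result; otherwise K ← 2K."
-- The relation holds of (x costs t) iff the loop started at K terminates with
-- result x after total time t.
data Doubling {A : Set} (f : ℕ → Timed (Maybe A)) (K : ℕ) : Timed A → Set where
  success : ∀ {x t} → f K ≡ (just x costs t) → Doubling f K (x costs t)
  failure : ∀ {x t u} → f K ≡ (nothing costs t) →
            Doubling f (2 * K) (x costs u) → Doubling f K (x costs (t + u))

module _ {n m : ℕ} (I : Instance n m) (ch : Choices I) where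
  open Instance I
  open Choices ch

  -- The state is a schedule together with the loads of the jobs handled so
  -- far; entries of jobs not yet handled still hold the prediction.
  -- A job costs a membership test, a scan of Γ j if needed, and an update.
  projectFrom : List (Fin n) → Schedule n m → (Fin m → ℕ) →
                Timed (Schedule n m)
  projectFrom []       σ ℓ = return σ
  projectFrom (j ∷ js) σ ℓ = do
    tick 1
    i ← if does (σ j ∈? Γ j)
          then return (σ j)
          else (tick ∣ Γ j ∣ >> return (least j ℓ))
    tick 1
    projectFrom js (updateAt σ j (const i)) (updateAt ℓ i (_+ p j))

  -- Initialising the loads costs m.
  project : Schedule n m → Timed (Schedule n m)
  project π̂ = tick m >> projectFrom order π̂ (const 0)

  module _ (dp : FixedSetProcedure) (T : ℚ) where
    open FixedSetProcedure dp

    -- The enumeration is lazy: producing the next A and its J_A costs m + n.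
    tryAll : Schedule n m → ℕ → List (Subset m) → Timed (Maybe (Schedule n m))
    tryAll σ̂ K []       = return nothing
    tryAll σ̂ K (A ∷ As) = do
      tick (m + n)
      just σ ← run I σ̂ T K A
        where nothing → tryAll σ̂ K As
      return (just σ)

    -- Computing O(T) costs m, comparing its size with 2K costs 1.
    globalRepairOracle : Schedule n m → ℕ → Timed (Maybe (Schedule n m))
    globalRepairOracle σ̂ K = do
      tick (m + 1)
      if does (2 * K ℕ.<? ∣ overloaded I σ̂ T ∣)
        then return nothing
        else tryAll σ̂ K (supersets (overloaded I σ̂ T) (2 * K))

    -- GlobalRepair π̂ (σ costs t) holds iff the algorithm on (T, π̂) terminates
    -- and returns σ after time t.  Computing Δ(T) from the loads costs m.
    data GlobalRepair (π̂ : Schedule n m) : Timed (Schedule n m) → Set where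
      unchanged : ∀ {σ̂ s} → project π̂ ≡ (σ̂ costs s) →
                  Δ I σ̂ T ≡ 0ℚ →
                  GlobalRepair π̂ (σ̂ costs (s + m))
      repaired  : ∀ {σ̂ s σ t} → project π̂ ≡ (σ̂ costs s) →
                  Δ I σ̂ T ≢ 0ℚ →
                  Doubling (globalRepairOracle σ̂) ℤ.∣ ⌈ Δ I σ̂ T ⌉ ∣ (σ costs t) →
                  GlobalRepair π̂ (σ costs (s + m + t))

{-# OPTIONS --safe #-}
module Submission where

-- An optimal schedule σ* realising the error differs from the projection σ̂ only
-- on jobs on which it differs from π̂, so move(σ*, σ̂) ≤ ℰ.  Load above T must be
-- moved away, so Δ(T) ≤ move(σ*, σ̂) and the search starts at some K ≤ ℰ.  The
-- source and target machines of the moved jobs form a set A with O(T) ⊆ A and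
-- ∣A∣ ≤ 2ℰ for which σ* is a repair; hence the oracle succeeds as soon as K ≥ ℰ,
-- and K < 2ℰ throughout.

open import Defs
open import Data.Nat.Base using (ℕ; _+_; _*_; _^_; _≤_)
open import Data.Nat.Logarithm using (⌊log₂_⌋)
open import Data.Product.Base using (∃-syntax; _×_)
open import Data.Rational.Base as ℚ using (ℚ; 0ℚ)

open import Data.Bool.Base using (true; if_then_else_)
open import Data.Fin.Base using (Fin; zero; suc)
import Data.Fin.Properties as Fin
open import Data.Fin.Subset using (Subset; inside; outside; _∈_; _⊆_; Nonempty; ∣_∣; ⊥; ⁅_⁆; _∪_; ⋃)
open import Data.Fin.Subset.Properties
  using (_∈?_; p⊆q⇒∣p∣≤∣q∣; x∈⁅x⁆; ∣⁅x⁆∣≡1; ∣⊥∣≡0; x∈p∪q⁺; ∣p∣≤n)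
import Data.Integer.Base as ℤ
import Data.Integer.Properties as ℤ
open import Data.List.Base using (List; []; _∷_; _++_; length; lookup; map; tabulate)
open import Data.List.Extrema.Nat using (xs≤max)
import Data.List.Membership.Propositional as List using (_∈_)
import Data.List.Membership.Propositional.Properties as List
open import Data.List.Membership.Setoid.Properties using (index-injective)
open import Data.List.Properties using (length-++; length-map; length-tabulate)
import Data.List.Relation.Unary.All as All
open import Data.List.Relation.Unary.All.Properties using (tabulate⁻)
open import Data.List.Relation.Unary.AllPairs using (_∷_)
open import Data.List.Relation.Unary.Any using (here; there; index)
open import Data.List.Relation.Unary.Unique.Propositional using (Unique)
open import Data.List.Relation.Binary.Permutation.Propositional using (↭-sym)
open import Data.List.Relation.Binary.Permutation.Propositional.Properties using (∈-resp-↭; ↭-length)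
open import Data.Maybe.Base using (Maybe; just; nothing; maybe′)
open import Data.Nat.Base using (zero; suc; _<_; _∸_; z≤n; s≤s; NonZero; >-nonZero)
import Data.Nat.Base as ℕ
import Data.Nat.DivMod as ℕ
import Data.Nat.Properties as ℕ
open import Data.Nat.Tactic.RingSolver using (solve-∀)
open import Data.Product.Base using (_,_; proj₁; proj₂)
import Data.Rational.Properties as ℚ
import Data.Rational.Unnormalised.Base as ℚᵘ
import Data.Rational.Unnormalised.Properties as ℚᵘ
open import Data.Sum.Base using (_⊎_; inj₁; inj₂; [_,_]′)
open import Data.Vec.Base using ([]; _∷_)
import Data.Vec.Properties as Vec
open import Data.Vec.Functional using (updateAt)
open import Data.Vec.Functional.Properties using (updateAt-updates; updateAt-minimal)
open import Function.Base using (_∘_; const)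
open import Function.Bundles using (Equivalence)
open import Relation.Binary.PropositionalEquality
  using (_≡_; _≢_; refl; sym; trans; cong; cong₂; subst; setoid)
open import Relation.Nullary.Decidable using (does; yes; no; Dec; dec-true)
open import Relation.Nullary.Negation.Core using (¬_; contradiction)

open import Algebra.Properties.CommutativeMonoid.Sum ℕ.+-0-commutativeMonoid
  using (sum-replicate-zero; ∑-distrib-+; ∑-comm; sum-cong-≗) renaming (sum to sumℕ)
open import Algebra.Properties.CommutativeMonoid.Sum ℚ.+-0-commutativeMonoid
  using () renaming (sum to sumℚ)

dec-true⁻ : {P : Set} (a? : Dec P) → does a? ≡ true → P
dec-true⁻ (yes a) _ = a

-- Finite sums

sumℕ-mono : ∀ {n} {f g : Fin n → ℕ} → (∀ i → f i ≤ g i) → sumℕ f ≤ sumℕ g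
sumℕ-mono {zero}  f≤g = z≤n
sumℕ-mono {suc n} f≤g = ℕ.+-mono-≤ (f≤g zero) (sumℕ-mono (f≤g ∘ suc))

sumℕ-positive : ∀ {n} (f : Fin n → ℕ) → 0 < sumℕ f → ∃[ i ] 0 < f i
sumℕ-positive {suc n} f 0<Σ with f zero in eq
... | suc _ = zero , subst (0 <_) (sym eq) (s≤s z≤n)
... | zero  = let (i , 0<fi) = sumℕ-positive (f ∘ suc) 0<Σ in suc i , 0<fi

sumℕ-indicator : ∀ {n} (x : Fin n) c →
                 sumℕ (λ i → if does (x Fin.≟ i) then c else 0) ≡ c
sumℕ-indicator {suc n} zero    c =
  trans (cong (c +_) (sum-replicate-zero n)) (ℕ.+-identityʳ c)
sumℕ-indicator {suc n} (suc x) c = sumℕ-indicator x c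

sumℚ-positive : ∀ {n} (f : Fin n → ℚ) → 0ℚ ℚ.< sumℚ f → ∃[ i ] 0ℚ ℚ.< f i
sumℚ-positive {zero}  f 0<Σ = contradiction 0<Σ (ℚ.<-irrefl refl)
sumℚ-positive {suc n} f 0<Σ with 0ℚ ℚ.<? f zero
... | yes 0<f₀ = zero , 0<f₀
-- A nonpositive head can only lower the sum, so the tail already has a positive sum.
... | no  0≮f₀ =
  let (i , 0<fi) = sumℚ-positive (f ∘ suc) (ℚ.<-≤-trans 0<Σ
        (subst (sumℚ f ℚ.≤_) (ℚ.+-identityˡ _)
          (ℚ.+-monoˡ-≤ (sumℚ (f ∘ suc)) (ℚ.≮⇒≥ 0≮f₀))))
  in suc i , 0<fi

-- Rational bounds

-- `toℚ` divides out a gcd and does not reduce on a variable. Passing to unnormalised rationals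
-- gives back the plain fraction with denominator 1, on which order and addition are integer facts.
toℚᵘ-toℚ : ∀ k → ℚ.toℚᵘ (toℚ k) ℚᵘ.≃ ℚᵘ.mkℚᵘ (ℤ.+ k) 0
toℚᵘ-toℚ k = ℚ.toℚᵘ-fromℚᵘ (ℚᵘ.mkℚᵘ (ℤ.+ k) 0)

toℚ-mono : ∀ {k l} → k ≤ l → toℚ k ℚ.≤ toℚ l
toℚ-mono {k} {l} k≤l = ℚ.toℚᵘ-cancel-≤ (begin
  ℚ.toℚᵘ (toℚ k)    ≃⟨ toℚᵘ-toℚ k ⟩
  ℚᵘ.mkℚᵘ (ℤ.+ k) 0 ≤⟨ ℚᵘ.*≤* (ℤ.*-monoʳ-≤-nonNeg (ℤ.+ 1) (ℤ.+≤+ k≤l)) ⟩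
  ℚᵘ.mkℚᵘ (ℤ.+ l) 0 ≃⟨ toℚᵘ-toℚ l ⟨
  ℚ.toℚᵘ (toℚ l)    ∎)
  where open ℚᵘ.≤-Reasoning

toℚ-+ : ∀ k l → toℚ (k + l) ≡ toℚ k ℚ.+ toℚ l
toℚ-+ k l = ℚ.toℚᵘ-injective (begin
  ℚ.toℚᵘ (toℚ (k + l))                    ≈⟨ toℚᵘ-toℚ (k + l) ⟩
  ℚᵘ.mkℚᵘ (ℤ.+ (k + l)) 0                 ≈⟨ ℚᵘ.*≡* (cong (ℤ._* ℤ.+ 1) (sym (cong₂ ℤ._+_
                                              (ℤ.*-identityʳ (ℤ.+ k)) (ℤ.*-identityʳ (ℤ.+ l))))) ⟩
  ℚᵘ.mkℚᵘ (ℤ.+ k) 0 ℚᵘ.+ ℚᵘ.mkℚᵘ (ℤ.+ l) 0 ≈⟨ ℚᵘ.+-cong (toℚᵘ-toℚ k) (toℚᵘ-toℚ l) ⟨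
  ℚ.toℚᵘ (toℚ k) ℚᵘ.+ ℚ.toℚᵘ (toℚ l)      ≈⟨ ℚ.toℚᵘ-homo-+ (toℚ k) (toℚ l) ⟨
  ℚ.toℚᵘ (toℚ k ℚ.+ toℚ l)                ∎)
  where open import Relation.Binary.Reasoning.Setoid ℚᵘ.≃-setoid

sumℚ≤toℚ-sumℕ : ∀ {n} {f : Fin n → ℚ} {g : Fin n → ℕ} →
                (∀ i → f i ℚ.≤ toℚ (g i)) → sumℚ f ℚ.≤ toℚ (sumℕ g)
sumℚ≤toℚ-sumℕ {zero}          f≤g = ℚ.≤-refl
sumℚ≤toℚ-sumℕ {suc n} {f} {g} f≤g =
  subst (sumℚ f ℚ.≤_) (sym (toℚ-+ (g zero) (sumℕ (g ∘ suc))))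
    (ℚ.+-mono-≤ (f≤g zero) (sumℚ≤toℚ-sumℕ (f≤g ∘ suc)))

p≤q+r⇒p-q≤r : ∀ {p q r} → p ℚ.≤ q ℚ.+ r → p ℚ.- q ℚ.≤ r
p≤q+r⇒p-q≤r {p} {q} {r} p≤q+r = begin
  p ℚ.- q             ≤⟨ ℚ.+-monoˡ-≤ (ℚ.- q) p≤q+r ⟩
  (q ℚ.+ r) ℚ.- q     ≡⟨ cong (ℚ._- q) (ℚ.+-comm q r) ⟩
  (r ℚ.+ q) ℚ.- q     ≡⟨ ℚ.+-assoc r q (ℚ.- q) ⟩
  r ℚ.+ (q ℚ.- q)     ≡⟨ cong (r ℚ.+_) (ℚ.+-inverseʳ q) ⟩
  r ℚ.+ 0ℚ            ≡⟨ ℚ.+-identityʳ r ⟩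
  r                   ∎
  where open ℚ.≤-Reasoning

0<p-q⇒q<p : ∀ {p q} → 0ℚ ℚ.< p ℚ.- q → q ℚ.< p
0<p-q⇒q<p {p} {q} 0<p-q = ℚ.≰⇒> λ p≤q → ℚ.<-irrefl refl
  (ℚ.<-≤-trans 0<p-q (p≤q+r⇒p-q≤r (ℚ.≤-trans p≤q (ℚ.≤-reflexive (sym (ℚ.+-identityʳ q))))))

0<p⊔0⇒0<p : ∀ {p} → 0ℚ ℚ.< p ℚ.⊔ 0ℚ → 0ℚ ℚ.< p
0<p⊔0⇒0<p {p} 0<p⊔0 with ℚ.⊔-sel p 0ℚ
... | inj₁ eq = subst (0ℚ ℚ.<_) eq 0<p⊔0
... | inj₂ eq = contradiction (subst (0ℚ ℚ.<_) eq 0<p⊔0) (ℚ.<-irrefl refl)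

-- This places the initial `K` of the search between 1 and the error, once `q` is `Δ`. A ceiling is
-- minus the floor of the negation, so everything comes down to integer division of a negative
-- numerator by `d`.
∣ceiling∣-bounds : ∀ q k → 0ℚ ℚ.< q → q ℚ.≤ toℚ k →
                   1 ≤ ℤ.∣ ℚ.ceiling q ∣ × ℤ.∣ ℚ.ceiling q ∣ ≤ k
∣ceiling∣-bounds (ℚ.mkℚ ℤ.-[1+ _ ] _ _) k (ℚ.*<* ()) _
∣ceiling∣-bounds (ℚ.mkℚ (ℤ.+ 0) _ _) k (ℚ.*<* (ℤ.+<+ ())) _
∣ceiling∣-bounds q@(ℚ.mkℚ (ℤ.+ suc a) d-1 c) k _ q≤k =
  subst (λ x → 1 ≤ x × x ≤ k) (sym ∣ceiling∣≡) bounds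
  where
  d = suc d-1

  -- The inequality `q ≤ k` with denominators cleared.
  a<kd : suc a ≤ k * d
  a<kd = subst (_≤ k * d) (ℕ.*-identityʳ (suc a)) (ℤ.drop‿+≤+
    (subst (ℤ._≤_ _) (sym (ℤ.pos-* k d)) (ℚᵘ.drop-*≤*
      (ℚᵘ.≤-respʳ-≃ (toℚᵘ-toℚ k) (ℚ.toℚᵘ-mono-≤ q≤k)))))

  ∣ceiling∣≡ : ℤ.∣ ℚ.ceiling q ∣ ≡ ℤ.∣ ℤ.-[1+ a ] ℤ./ℕ d ∣
  ∣ceiling∣≡ = trans (ℤ.∣-i∣≡∣i∣ (ℚ.floor (ℚ.- q))) (cong ℤ.∣_∣ (ℤ.*-identityˡ (ℤ.-[1+ a ] ℤ./ℕ d)))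

  bounds : 1 ≤ ℤ.∣ ℤ.-[1+ a ] ℤ./ℕ d ∣ × ℤ.∣ ℤ.-[1+ a ] ℤ./ℕ d ∣ ≤ k
  bounds with suc a ℕ.% d | ℕ.m≡m%n+[m/n]*n (suc a) d
  -- With a nonzero remainder the ceiling is one more than the quotient, so the quotient must be
  -- strictly below `k`; the positive remainder provides the strictness.
  ... | suc r | eq = s≤s z≤n , ℕ.*-cancelʳ-< d (suc a ℕ./ d) k
    (ℕ.<-≤-trans (s≤s (ℕ.m≤n+m (suc a ℕ./ d * d) r)) (subst (_≤ k * d) eq a<kd))
  -- With remainder zero the ceiling is the quotient itself, which cannot be zero because the
  -- numerator is `suc a`.
  ... | zero  | eq with suc a ℕ./ d | eq
  ...   | suc e | eq′ = s≤s z≤n , ℕ.*-cancelʳ-≤ (suc e) k d (subst (_≤ k * d) eq′ a<kd)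

-- Counting sets of bounded size

module _ {A : Set} where

  lookup-injective : ∀ {xs : List A} → Unique xs → ∀ i j →
                     lookup xs i ≡ lookup xs j → i ≡ j
  lookup-injective (x∉ ∷ u) zero    zero    eq = refl
  lookup-injective {x ∷ xs} (x∉ ∷ u) zero    (suc j) eq =
    contradiction eq (All.lookup x∉ (List.∈-lookup {xs = xs} j))
  lookup-injective {x ∷ xs} (x∉ ∷ u) (suc i) zero    eq =
    contradiction (sym eq) (All.lookup x∉ (List.∈-lookup {xs = xs} i))
  lookup-injective (x∉ ∷ u) (suc i) (suc j) eq = cong suc (lookup-injective u i j eq)

  -- Sending each position of `xs` to a position of the same element in `ys` is injective when `xs`
  -- has no repetitions.
  Unique-⊆-length : ∀ {xs ys : List A} → Unique xs →
                    (∀ {x} → x List.∈ xs → x List.∈ ys) → length xs ≤ length ys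
  Unique-⊆-length {xs} {ys} u xs⊆ys = Fin.injective⇒≤
    {f = λ i → index (xs⊆ys (List.∈-lookup {xs = xs} i))}
    λ {i} {j} eq → lookup-injective u i j
      (index-injective (setoid A) (xs⊆ys (List.∈-lookup i)) (xs⊆ys (List.∈-lookup j)) eq)

-- A concrete list against which the abstract enumeration `supersets` is measured. The recursion is
-- Pascal's rule: the first machine is either left out or uses up one unit of the size budget.
subsetsUpTo : ∀ m → ℕ → List (Subset m)
subsetsUpTo zero    k       = [] ∷ []
subsetsUpTo (suc m) zero    = map (outside ∷_) (subsetsUpTo m zero)
subsetsUpTo (suc m) (suc k) =
  map (outside ∷_) (subsetsUpTo m (suc k)) ++ map (inside ∷_) (subsetsUpTo m k)

∈-subsetsUpTo : ∀ {m} (A : Subset m) k → ∣ A ∣ ≤ k → A List.∈ subsetsUpTo m k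
∈-subsetsUpTo []            k       _         = here refl
∈-subsetsUpTo (outside ∷ A) zero    ∣A∣≤k       = List.∈-map⁺ _ (∈-subsetsUpTo A zero ∣A∣≤k)
∈-subsetsUpTo (outside ∷ A) (suc k) ∣A∣≤k       =
  List.∈-++⁺ˡ (List.∈-map⁺ _ (∈-subsetsUpTo A (suc k) ∣A∣≤k))
∈-subsetsUpTo (inside ∷ A)  (suc k) (s≤s ∣A∣≤k) =
  List.∈-++⁺ʳ _ (List.∈-map⁺ _ (∈-subsetsUpTo A k ∣A∣≤k))

-- Pascal's rule gives (m+1)^(k+1) + (m+1)^k = (m+2)(m+1)^k, which is at most (m+2)^(k+1). The base
-- is `suc m` because the empty set is counted too: for m = k = 1 there are two sets.
length-subsetsUpTo : ∀ m k → length (subsetsUpTo m k) ≤ suc m ^ k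
length-subsetsUpTo zero    k       = ℕ.≤-reflexive (sym (ℕ.^-zeroˡ k))
length-subsetsUpTo (suc m) zero    =
  ℕ.≤-trans (ℕ.≤-reflexive (length-map _ (subsetsUpTo m zero))) (length-subsetsUpTo m zero)
length-subsetsUpTo (suc m) (suc k) = begin
  length (subsetsUpTo (suc m) (suc k))
    ≡⟨ length-++ (map (outside ∷_) (subsetsUpTo m (suc k))) ⟩
  length (map (outside ∷_) (subsetsUpTo m (suc k))) + length (map (inside ∷_) (subsetsUpTo m k))
    ≡⟨ cong₂ _+_ (length-map _ (subsetsUpTo m (suc k))) (length-map _ (subsetsUpTo m k)) ⟩
  length (subsetsUpTo m (suc k)) + length (subsetsUpTo m k)
    ≤⟨ ℕ.+-mono-≤ (length-subsetsUpTo m (suc k)) (length-subsetsUpTo m k) ⟩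
  suc m * suc m ^ k + suc m ^ k
    ≡⟨ ℕ.+-comm (suc m * suc m ^ k) _ ⟩
  suc (suc m) * suc m ^ k
    ≤⟨ ℕ.*-monoʳ-≤ (suc (suc m)) (ℕ.^-monoˡ-≤ k (ℕ.n≤1+n (suc m))) ⟩
  suc (suc m) * suc (suc m) ^ k ∎
  where open ℕ.≤-Reasoning

∣p∪q∣≤∣p∣+∣q∣ : ∀ {n} (p q : Subset n) → ∣ p ∪ q ∣ ≤ ∣ p ∣ + ∣ q ∣
∣p∪q∣≤∣p∣+∣q∣ []            []            = z≤n
∣p∪q∣≤∣p∣+∣q∣ (outside ∷ p) (outside ∷ q) = ∣p∪q∣≤∣p∣+∣q∣ p q
∣p∪q∣≤∣p∣+∣q∣ (inside  ∷ p) (outside ∷ q) = s≤s (∣p∪q∣≤∣p∣+∣q∣ p q)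
∣p∪q∣≤∣p∣+∣q∣ (outside ∷ p) (inside  ∷ q) =
  ℕ.≤-trans (s≤s (∣p∪q∣≤∣p∣+∣q∣ p q)) (ℕ.≤-reflexive (sym (ℕ.+-suc _ _)))
∣p∪q∣≤∣p∣+∣q∣ (inside  ∷ p) (inside  ∷ q) =
  s≤s (ℕ.≤-trans (∣p∪q∣≤∣p∣+∣q∣ p q) (ℕ.+-monoʳ-≤ ∣ p ∣ (ℕ.n≤1+n ∣ q ∣)))

∣⋃∣≤sumℕ : ∀ {n m} (F : Fin n → Subset m) → ∣ ⋃ (tabulate F) ∣ ≤ sumℕ (∣_∣ ∘ F)
∣⋃∣≤sumℕ {zero}  {m} F = ℕ.≤-reflexive (∣⊥∣≡0 m)
∣⋃∣≤sumℕ {suc n} F = ℕ.≤-trans (∣p∪q∣≤∣p∣+∣q∣ (F zero) (⋃ (tabulate (F ∘ suc))))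
  (ℕ.+-monoʳ-≤ ∣ F zero ∣ (∣⋃∣≤sumℕ (F ∘ suc)))

x∈⋃⁺ : ∀ {n m} (F : Fin n → Subset m) j {x} → x ∈ F j → x ∈ ⋃ (tabulate F)
x∈⋃⁺ F zero    x∈ = x∈p∪q⁺ (inj₁ x∈)
x∈⋃⁺ F (suc j) x∈ = x∈p∪q⁺ (inj₂ (x∈⋃⁺ (F ∘ suc) j x∈))

-- The doubling search

module _ {A : Set} (f : ℕ → Timed (Maybe A)) where

  -- A round is repeated only after a failure at some K < E, so the doubled value stays below 2E and
  -- every round costs at most `B`. The crude count of `E` rounds is enough, since a factor `E` is
  -- absorbed later. The final `K′` is kept so that soundness of the successful call can be invoked.
  doubling-terminates :
    ∀ {B} E →
      (∀ K → 1 ≤ K → result (f K) ≡ nothing → K < E) →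
      (∀ K → 1 ≤ K → K ≤ 2 * E → time (f K) ≤ B) →
      ∀ K → 1 ≤ K → K ≤ E →
      ∃[ x ] ∃[ t ] Doubling f K (x costs t) × t ≤ E * B ×
        ∃[ K′ ] (1 ≤ K′ × result (f K′) ≡ just x)
  doubling-terminates zero _ _ K 1≤K K≤E = contradiction (ℕ.≤-trans 1≤K K≤E) λ ()
  doubling-terminates {B} (suc r) fails⇒< time≤ K₀ 1≤K₀ K₀≤E =
    loop r K₀ 1≤K₀ (ℕ.≤-trans K₀≤E (ℕ.m≤m+n E _)) (ℕ.+-monoˡ-≤ r 1≤K₀)
    where
    E = suc r
    -- `s` is fuel, bounding the distance from `K` up to `E`. As the start is at least 1, fuel E - 1
    -- suffices, which allows `E` rounds.
    loop : ∀ s K → 1 ≤ K → K ≤ 2 * E → E ≤ K + s →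
           ∃[ x ] ∃[ t ] Doubling f K (x costs t) × t ≤ suc s * B ×
             ∃[ K′ ] (1 ≤ K′ × result (f K′) ≡ just x)
    loop s K 1≤K K≤2E E≤K+s with result (f K) in eq
    ... | just x  = x , time (f K) , success (cong (_costs time (f K)) eq) ,
                    ℕ.≤-trans (time≤ K 1≤K K≤2E) (ℕ.m≤m+n B (s * B)) , K , 1≤K , eq
    -- Without fuel `K` has reached `E`, where failure is impossible.
    loop zero    K 1≤K K≤2E E≤K+s | nothing =
      contradiction (ℕ.≤-trans E≤K+s (ℕ.≤-reflexive (ℕ.+-identityʳ K))) (ℕ.<⇒≱ (fails⇒< K 1≤K eq))
    loop (suc s) K 1≤K K≤2E E≤K+s | nothing =
      let K<E = fails⇒< K 1≤K eq
          (x , t , dbl , t≤ , found) = loop s (2 * K) (ℕ.≤-trans 1≤K (ℕ.m≤m+n K _))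
            (ℕ.*-monoʳ-≤ 2 (ℕ.<⇒≤ K<E))
            -- Since K ≥ 1, doubling raises `K` by at least the one unit of fuel spent.
            (ℕ.≤-trans E≤K+s (ℕ.≤-trans (ℕ.+-monoʳ-≤ K (ℕ.+-monoˡ-≤ s 1≤K))
              (ℕ.≤-reflexive (shuffle K s))))
      in x , time (f K) + t , failure (cong (_costs time (f K)) eq) dbl ,
         ℕ.+-mono-≤ (time≤ K 1≤K K≤2E) t≤ , found
      where
      shuffle : ∀ K s → K + (K + s) ≡ 2 * K + s
      shuffle = solve-∀

-- Moving jobs between two schedules

module _ {n m : ℕ} (I : Instance n m) where
  open Instance I

  load≤Cmax : ∀ σ i → load I σ i ≤ Cmax I σ
  load≤Cmax σ = tabulate⁻ (xs≤max 0 (tabulate (load I σ)))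

  ∈-overloaded⁻ : ∀ σ T i → i ∈ overloaded I σ T → T ℚ.< toℚ (load I σ i)
  ∈-overloaded⁻ σ T i i∈ = dec-true⁻ (T ℚ.<? toℚ (load I σ i))
    (trans (sym (Vec.lookup∘tabulate (λ i → does (T ℚ.<? toℚ (load I σ i))) i)) (Vec.[]=⇒lookup i∈))

  ∈-overloaded⁺ : ∀ σ T i → T ℚ.< toℚ (load I σ i) → i ∈ overloaded I σ T
  ∈-overloaded⁺ σ T i T<L = Vec.lookup⇒[]= i _
    (trans (Vec.lookup∘tabulate _ i) (dec-true (T ℚ.<? toℚ (load I σ i)) T<L))

  Δ-positive : ∀ σ T → 0ℚ ℚ.< Δ I σ T → Nonempty (overloaded I σ T)
  Δ-positive σ T 0<Δ =
    let (i , 0<x⊔0) = sumℚ-positive (λ i → (toℚ (load I σ i) ℚ.- T) ℚ.⊔ 0ℚ) 0<Δ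
    in i , ∈-overloaded⁺ σ T i (0<p-q⇒q<p (0<p⊔0⇒0<p 0<x⊔0))

  cost : Schedule n m → Schedule n m → Fin n → ℕ
  cost τ σ j = if does (τ j Fin.≟ σ j) then 0 else p j

  cost-positive : ∀ τ σ j → 0 < cost τ σ j → τ j ≢ σ j
  cost-positive τ σ j 0<c with τ j Fin.≟ σ j
  ... | no τj≢σj = τj≢σj

  -- The processing time that leaves machine `i` when `σ` is changed into `τ`.
  outflow : Schedule n m → Schedule n m → Fin m → ℕ
  outflow τ σ i = sumℕ λ j → if does (σ j Fin.≟ i) then cost τ σ j else 0

  outflow-positive : ∀ τ σ i → 0 < outflow τ σ i → ∃[ j ] σ j ≡ i × τ j ≢ σ j
  outflow-positive τ σ i 0<out with sumℕ-positive _ 0<out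
  ... | j , 0<x with σ j Fin.≟ i
  ...   | yes σj≡i = j , σj≡i , cost-positive τ σ j 0<x

  -- After exchanging the sums, each moved job is counted once, at the single machine `σ j` that it
  -- leaves.
  sum-outflow : ∀ τ σ → sumℕ (outflow τ σ) ≡ move I τ σ
  sum-outflow τ σ = trans
    (∑-comm λ i j → if does (σ j Fin.≟ i) then cost τ σ j else 0)
    (sum-cong-≗ λ j → sumℕ-indicator (σ j) (cost τ σ j))

  -- A job that `σ` puts on `i` either is still there under `τ` or contributes to the outflow of
  -- `i`.
  load≤load+outflow : ∀ τ σ i → load I σ i ≤ load I τ i + outflow τ σ i
  load≤load+outflow τ σ i = ℕ.≤-trans (sumℕ-mono pointwise)
    (ℕ.≤-reflexive (∑-distrib-+ (λ j → if does (τ j Fin.≟ i) then p j else 0)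
                                (λ j → if does (σ j Fin.≟ i) then cost τ σ j else 0)))
    where
    pointwise : ∀ j → (if does (σ j Fin.≟ i) then p j else 0) ≤
                      (if does (τ j Fin.≟ i) then p j else 0) +
                      (if does (σ j Fin.≟ i) then cost τ σ j else 0)
    pointwise j with σ j Fin.≟ i | τ j Fin.≟ i
    ... | no _     | _        = z≤n
    ... | yes _    | yes _    = ℕ.m≤m+n (p j) _
    ... | yes σj≡i | no τj≢i with τ j Fin.≟ σ j
    ...   | yes τj≡σj = contradiction (trans τj≡σj σj≡i) τj≢i
    ...   | no  _     = ℕ.≤-refl

  module _ {τ : Schedule n m} {T : ℚ} (Cmax≤T : toℚ (Cmax I τ) ℚ.≤ T) (σ : Schedule n m) where

    private
      toℚ-load≤T : ∀ i → toℚ (load I τ i) ℚ.≤ T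
      toℚ-load≤T i = ℚ.≤-trans (toℚ-mono {load I τ i} {Cmax I τ} (load≤Cmax τ i)) Cmax≤T

    -- Under `τ` machine `i` carries at most `T`, so the excess of `σ` on `i` is at most the outflow
    -- of `i`. Summing over machines turns the outflows into `move`.
    Δ≤move : Δ I σ T ℚ.≤ toℚ (move I τ σ)
    Δ≤move = subst (λ x → Δ I σ T ℚ.≤ toℚ x) (sum-outflow τ σ) (sumℚ≤toℚ-sumℕ λ i →
      ℚ.⊔-lub (p≤q+r⇒p-q≤r {q = T} (begin
          toℚ (load I σ i)                           ≤⟨ toℚ-mono {load I σ i} (load≤load+outflow τ σ i) ⟩
          toℚ (load I τ i + outflow τ σ i)           ≡⟨ toℚ-+ (load I τ i) (outflow τ σ i) ⟩
          toℚ (load I τ i) ℚ.+ toℚ (outflow τ σ i)   ≤⟨ ℚ.+-monoˡ-≤ _ (toℚ-load≤T i) ⟩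
          T ℚ.+ toℚ (outflow τ σ i)                  ∎))
        (toℚ-mono {0} {outflow τ σ i} z≤n))
      where open ℚ.≤-Reasoning

    -- With zero outflow the load of `i` under `σ` would be at most its load under `τ`, hence at
    -- most `T`.
    overloaded⇒moved : ∀ {i} → i ∈ overloaded I σ T → ∃[ j ] σ j ≡ i × τ j ≢ σ j
    overloaded⇒moved {i} i∈ = outflow-positive τ σ i (ℕ.n≢0⇒n>0 λ out≡0 →
      ℚ.<-irrefl refl (ℚ.<-≤-trans (∈-overloaded⁻ σ T i i∈) (ℚ.≤-trans
        (toℚ-mono {load I σ i} {load I τ i} (ℕ.≤-trans (load≤load+outflow τ σ i) (ℕ.≤-reflexive
          (trans (cong (load I τ i +_) out≡0) (ℕ.+-identityʳ _)))))
        (toℚ-load≤T i))))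

  -- The machines touched by moved jobs

  touchedBy : Schedule n m → Schedule n m → Fin n → Subset m
  touchedBy τ σ j = if does (τ j Fin.≟ σ j) then ⊥ else ⁅ σ j ⁆ ∪ ⁅ τ j ⁆

  touched : Schedule n m → Schedule n m → Subset m
  touched τ σ = ⋃ (tabulate (touchedBy τ σ))

  -- A moved job touches at most two machines and costs `p j`, which is at least 1, so twice its
  -- cost pays for both.
  ∣touched∣≤2*move : ∀ τ σ → ∣ touched τ σ ∣ ≤ 2 * move I τ σ
  ∣touched∣≤2*move τ σ = begin
    ∣ touched τ σ ∣                       ≤⟨ ∣⋃∣≤sumℕ (touchedBy τ σ) ⟩
    sumℕ (∣_∣ ∘ touchedBy τ σ)            ≤⟨ sumℕ-mono size ⟩
    sumℕ (λ j → cost τ σ j + cost τ σ j)  ≡⟨ ∑-distrib-+ (cost τ σ) (cost τ σ) ⟩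
    move I τ σ + move I τ σ               ≡⟨ cong (move I τ σ +_) (ℕ.+-identityʳ _) ⟨
    2 * move I τ σ                        ∎
    where
    open ℕ.≤-Reasoning
    size : ∀ j → ∣ touchedBy τ σ j ∣ ≤ cost τ σ j + cost τ σ j
    size j with τ j Fin.≟ σ j
    ... | yes _ = ℕ.≤-reflexive (∣⊥∣≡0 m)
    ... | no  _ = ℕ.≤-trans (∣p∪q∣≤∣p∣+∣q∣ ⁅ σ j ⁆ ⁅ τ j ⁆)
      (ℕ.+-mono-≤ (ℕ.≤-trans (ℕ.≤-reflexive (∣⁅x⁆∣≡1 (σ j))) (p≥1 j))
                  (ℕ.≤-trans (ℕ.≤-reflexive (∣⁅x⁆∣≡1 (τ j))) (p≥1 j)))

  moved⇒touched : ∀ τ σ j → τ j ≢ σ j → σ j ∈ touched τ σ × τ j ∈ touched τ σ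
  moved⇒touched τ σ j τj≢σj = x∈⋃⁺ (touchedBy τ σ) j (proj₁ both) , x∈⋃⁺ (touchedBy τ σ) j (proj₂ both)
    where
    both : σ j ∈ touchedBy τ σ j × τ j ∈ touchedBy τ σ j
    both with τ j Fin.≟ σ j
    ... | yes τj≡σj = contradiction τj≡σj τj≢σj
    ... | no  _     = x∈p∪q⁺ (inj₁ (x∈⁅x⁆ _)) , x∈p∪q⁺ (inj₂ (x∈⁅x⁆ _))

  untouched⇒fixed : ∀ τ σ j → ¬ (σ j ∈ touched τ σ) → τ j ≡ σ j
  untouched⇒fixed τ σ j σj∉ with τ j Fin.≟ σ j
  ... | yes τj≡σj = τj≡σj
  ... | no  τj≢σj = contradiction (proj₁ (moved⇒touched τ σ j τj≢σj)) σj∉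

  -- A job on a touched machine either stays there or is itself moved, and then its target is
  -- touched as well. This is what confines a repair to the touched machines.
  touched-closed : ∀ τ σ j → σ j ∈ touched τ σ → τ j ∈ touched τ σ
  touched-closed τ σ j σj∈ with τ j Fin.≟ σ j
  ... | yes τj≡σj = subst (_∈ touched τ σ) (sym τj≡σj) σj∈
  ... | no  τj≢σj = proj₂ (moved⇒touched τ σ j τj≢σj)

  touched-repair : ∀ {τ σ T K} → Feasible I τ → toℚ (Cmax I τ) ℚ.≤ T → move I τ σ ≤ K →
                   IsRepair I σ T K (touched τ σ) τ
  touched-repair {τ} {σ} feasible Cmax≤T move≤K = record
    { feasible    = feasible
    ; fixed-off-A = untouched⇒fixed τ σ
    ; stays-in-A  = λ j σj∈ → feasible j , touched-closed τ σ j σj∈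
    ; move≤K      = move≤K
    ; Cmax≤T      = Cmax≤T
    }

  -- Projection

  module _ (ch : Choices I) where
    open Choices ch

    -- The machine choice inside one step of `projectFrom`, named so that its outcome and its time
    -- can be analysed apart from the recursion.
    place : Schedule n m → (Fin m → ℕ) → Fin n → Timed (Fin m)
    place σ ℓ j = if does (σ j ∈? Γ j)
      then return (σ j)
      else (tick ∣ Γ j ∣ >> return (least j ℓ))

    place-eligible : ∀ σ ℓ j → result (place σ ℓ j) ∈ Γ j
    place-eligible σ ℓ j with σ j ∈? Γ j
    ... | yes σj∈ = σj∈
    ... | no  _   = least-∈ j ℓ

    place-keeps : ∀ σ ℓ j → σ j ∈ Γ j → result (place σ ℓ j) ≡ σ j
    place-keeps σ ℓ j σj∈ with σ j ∈? Γ j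
    ... | yes _   = refl
    ... | no  σj∉ = contradiction σj∈ σj∉

    place-time : ∀ σ ℓ j → time (place σ ℓ j) ≤ m
    place-time σ ℓ j with σ j ∈? Γ j
    ... | yes _ = z≤n
    ... | no  _ = ℕ.≤-trans (ℕ.≤-reflexive (ℕ.+-identityʳ _)) (∣p∣≤n (Γ j))

    -- Handling `k` leaves an eligible entry alone, and handling another job does not touch it. This
    -- serves twice: eligible predictions survive the projection, and an entry once made eligible is
    -- not changed afterwards.
    projectFrom-keeps : ∀ js σ ℓ k → σ k ∈ Γ k → result (projectFrom I ch js σ ℓ) k ≡ σ k
    projectFrom-keeps []       σ ℓ k σk∈ = refl
    projectFrom-keeps (j ∷ js) σ ℓ k σk∈ = trans
      (projectFrom-keeps js (updateAt σ j (const i)) _ k (subst (_∈ Γ k) (sym kept) σk∈)) kept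
      where
      i = result (place σ ℓ j)
      kept : updateAt σ j (const i) k ≡ σ k
      kept with k Fin.≟ j
      ... | yes refl = trans (updateAt-updates j σ) (place-keeps σ ℓ j σk∈)
      ... | no  k≢j  = updateAt-minimal k j σ k≢j

    projectFrom-eligible : ∀ js σ ℓ {k} → k List.∈ js → result (projectFrom I ch js σ ℓ) k ∈ Γ k
    projectFrom-eligible (j ∷ js) σ ℓ (there k∈) = projectFrom-eligible js _ _ k∈
    projectFrom-eligible (j ∷ js) σ ℓ (here refl) =
      subst (_∈ Γ j) (sym (projectFrom-keeps js σ′ _ j σ′j∈)) σ′j∈
      where
      σ′ = updateAt σ j (const (result (place σ ℓ j)))
      σ′j∈ : σ′ j ∈ Γ j
      σ′j∈ = subst (_∈ Γ j) (sym (updateAt-updates j σ)) (place-eligible σ ℓ j)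

    -- Per job there are two unit ticks and at most one scan of `Γ j`, of size at most `m`.
    projectFrom-time : ∀ js σ ℓ → time (projectFrom I ch js σ ℓ) ≤ length js * (2 + m)
    projectFrom-time []       σ ℓ = z≤n
    projectFrom-time (j ∷ js) σ ℓ = s≤s (begin
      t + (1 + rest)             ≡⟨ ℕ.+-suc t rest ⟩
      1 + (t + rest)             ≤⟨ s≤s (ℕ.+-mono-≤ (place-time σ ℓ j) (projectFrom-time js _ _)) ⟩
      1 + (m + length js * (2 + m)) ∎)
      where
      open ℕ.≤-Reasoning
      t = time (place σ ℓ j)
      rest = time (projectFrom I ch js (updateAt σ j (const (result (place σ ℓ j))))
                                       (updateAt ℓ (result (place σ ℓ j)) (_+ p j)))

    project-feasible : ∀ π → Feasible I (result (project I ch π))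
    project-feasible π j = projectFrom-eligible order π (const 0)
      (∈-resp-↭ (↭-sym order-↭) (List.∈-allFin j))

    project-time : ∀ π → time (project I ch π) ≤ m + n * (2 + m)
    project-time π = ℕ.+-monoʳ-≤ m (subst
      (λ l → time (projectFrom I ch order π (const 0)) ≤ l * (2 + m))
      (trans (↭-length order-↭) (length-tabulate {n = n} _)) (projectFrom-time order π (const 0)))

    -- The inequality holds job by job. If `τ` agrees with `π` on a job, feasibility of `τ` makes
    -- the prediction eligible, so the projection keeps it and agrees with `τ` too.
    move-project≤ : ∀ τ π → Feasible I τ → move I τ (result (project I ch π)) ≤ move I τ π
    move-project≤ τ π feasible = sumℕ-mono pointwise
      where
      σ̂ = result (project I ch π)
      pointwise : ∀ j → cost τ σ̂ j ≤ cost τ π j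
      pointwise j with τ j Fin.≟ σ̂ j | τ j Fin.≟ π j
      ... | yes _     | _         = z≤n
      ... | no  _     | no _      = ℕ.≤-refl
      ... | no  τj≢σ̂j | yes τj≡πj = contradiction
        (trans τj≡πj (sym (projectFrom-keeps order π (const 0) j
          (subst (_∈ Γ j) τj≡πj (feasible j))))) τj≢σ̂j

-- The oracle

maybe-just⇒ : {A : Set} (x : Maybe A) {y : Maybe A} {a : A} →
              maybe′ just y x ≡ just a → x ≡ just a ⊎ y ≡ just a
maybe-just⇒ (just _) eq = inj₁ eq
maybe-just⇒ nothing  eq = inj₂ eq

maybe-nothing⇒ : {A : Set} (x : Maybe A) {y : Maybe A} →
                 maybe′ just y x ≡ nothing → x ≡ nothing × y ≡ nothing
maybe-nothing⇒ nothing eq = refl , eq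

if-does-elim : {A P : Set} (Q : A → Set) (p? : Dec P) {x y : A} →
               (P → Q x) → (¬ P → Q y) → Q (if does p? then x else y)
if-does-elim Q (yes p) f g = f p
if-does-elim Q (no ¬p) f g = g ¬p

-- The enumeration has no repetitions and all its members occur in `subsetsUpTo m k`.
length-supersets : ∀ {n m} {I : Instance n m} (ch : Choices I) O k →
                   length (Choices.supersets ch O k) ≤ suc m ^ k
length-supersets {m = m} ch O k = ℕ.≤-trans
  (Unique-⊆-length (supersets-! O k) λ {A} A∈ →
    ∈-subsetsUpTo A k (proj₂ (Equivalence.to (supersets-∈ O k A) A∈)))
  (length-subsetsUpTo m k)
  where open Choices ch

module _ {n m : ℕ} (I : Instance n m) (ch : Choices I) (dp : FixedSetProcedure) (T : ℚ)
         (σ̂ : Schedule n m) (K : ℕ) where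
  open FixedSetProcedure dp
  open Choices ch

  private
    O = overloaded I σ̂ T

  tryAll-result : ∀ A As → result (tryAll I ch dp T σ̂ K (A ∷ As)) ≡
    maybe′ just (result (tryAll I ch dp T σ̂ K As)) (result (run I σ̂ T K A))
  tryAll-result A As with result (run I σ̂ T K A)
  ... | just _  = refl
  ... | nothing = refl

  -- Only an inequality: after a success the remaining sets are not tried.
  tryAll-time-∷ : ∀ A As → time (tryAll I ch dp T σ̂ K (A ∷ As)) ≤
    (m + n) + (time (run I σ̂ T K A) + time (tryAll I ch dp T σ̂ K As))
  tryAll-time-∷ A As with result (run I σ̂ T K A)
  ... | just _  = ℕ.+-monoʳ-≤ (m + n) (ℕ.+-monoʳ-≤ (time (run I σ̂ T K A)) z≤n)
  ... | nothing = ℕ.≤-refl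

  tryAll-sound : ∀ As {σ} → (∀ {A} → A List.∈ As → Admissible I σ̂ T K A) →
    result (tryAll I ch dp T σ̂ K As) ≡ just σ → ∃[ A ] IsRepair I σ̂ T K A σ
  tryAll-sound (A ∷ As) adm eq =
    [ (λ found → A , sound I σ̂ T K A (adm (here refl)) found)
    , tryAll-sound As (adm ∘ there)
    ]′ (maybe-just⇒ (result (run I σ̂ T K A)) (trans (sym (tryAll-result A As)) eq))

  tryAll-complete : ∀ As → result (tryAll I ch dp T σ̂ K As) ≡ nothing →
    ∀ {A} → A List.∈ As → result (run I σ̂ T K A) ≡ nothing
  tryAll-complete (A ∷ As) eq A∈
    with maybe-nothing⇒ (result (run I σ̂ T K A)) (trans (sym (tryAll-result A As)) eq) | A∈
  ... | failed , _ | here refl = failed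
  ... | _ , later  | there A∈′ = tryAll-complete As later A∈′

  tryAll-time : ∀ {B} As → (∀ {A} → A List.∈ As → (m + n) + time (run I σ̂ T K A) ≤ B) →
    time (tryAll I ch dp T σ̂ K As) ≤ length As * B
  tryAll-time []       bound = z≤n
  tryAll-time (A ∷ As) bound = ℕ.≤-trans (tryAll-time-∷ A As)
    (ℕ.≤-trans (ℕ.≤-reflexive (sym (ℕ.+-assoc (m + n) _ _)))
      (ℕ.+-mono-≤ (bound (here refl)) (tryAll-time As (bound ∘ there))))

  module _ (feasible : Feasible I σ̂) (1≤K : 1 ≤ K) (overload : Nonempty O) where

    superset-admissible : ∀ {A} → O ⊆ A → Admissible I σ̂ T K A
    superset-admissible O⊆A =
      feasible , 1≤K , (proj₁ overload , O⊆A (proj₂ overload)) , O⊆A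

    private
      ∈⇒⊆ : ∀ {A} → A List.∈ supersets O (2 * K) → O ⊆ A
      ∈⇒⊆ {A} A∈ = proj₁ (Equivalence.to (supersets-∈ O (2 * K) A) A∈)

      ∈⇒size : ∀ {A} → A List.∈ supersets O (2 * K) → ∣ A ∣ ≤ 2 * K
      ∈⇒size {A} A∈ = proj₂ (Equivalence.to (supersets-∈ O (2 * K) A) A∈)

    oracle-sound : ∀ {σ} → result (globalRepairOracle I ch dp T σ̂ K) ≡ just σ →
                   ∃[ A ] IsRepair I σ̂ T K A σ
    oracle-sound {σ} = if-does-elim
      (λ r → result r ≡ just σ → ∃[ A ] IsRepair I σ̂ T K A σ)
      (2 * K ℕ.<? ∣ O ∣)
      (λ _ ())
      (λ _ → tryAll-sound (supersets O (2 * K)) (λ A∈ → superset-admissible (∈⇒⊆ A∈)))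

    -- The set `A` bounds the size of `O`, so the early exit is not taken, and `A` is among the
    -- enumerated sets. Total failure would include failure on `A`, against completeness of the
    -- fixed-set procedure.
    oracle-complete : ∀ {A τ} → O ⊆ A → ∣ A ∣ ≤ 2 * K → IsRepair I σ̂ T K A τ →
                      result (globalRepairOracle I ch dp T σ̂ K) ≢ nothing
    oracle-complete {A} {τ} O⊆A ∣A∣≤2K repair = if-does-elim
      (λ r → result r ≢ nothing)
      (2 * K ℕ.<? ∣ O ∣)
      (λ 2K<∣O∣ _ → ℕ.<⇒≱ 2K<∣O∣ (ℕ.≤-trans (p⊆q⇒∣p∣≤∣q∣ O⊆A) ∣A∣≤2K))
      (λ _ failed → complete I σ̂ T K A (superset-admissible O⊆A)
        (tryAll-complete (supersets O (2 * K)) failed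
          (Equivalence.from (supersets-∈ O (2 * K) A) (O⊆A , ∣A∣≤2K)))
        (τ , repair))

    -- The bound depends on `K` only through `N`, so one value serves all rounds of the search.
    oracle-time : ∀ {N} → 2 * K ≤ N → time (globalRepairOracle I ch dp T σ̂ K) ≤
      (m + 1) + suc m ^ N * ((m + n) + κ * (n * m * (N + 1) ^ N))
    oracle-time {N} 2K≤N = ℕ.+-monoʳ-≤ (m + 1) (if-does-elim
      (λ r → time r ≤ suc m ^ N * B)
      (2 * K ℕ.<? ∣ O ∣)
      (λ _ → z≤n)
      (λ _ → ℕ.≤-trans (tryAll-time (supersets O (2 * K)) bound)
        (ℕ.*-monoˡ-≤ B (ℕ.≤-trans (length-supersets ch O (2 * K))
          (ℕ.^-monoʳ-≤ (suc m) 2K≤N)))))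
      where
      B = (m + n) + κ * (n * m * (N + 1) ^ N)

      bound : ∀ {A} → A List.∈ supersets O (2 * K) → (m + n) + time (run I σ̂ T K A) ≤ B
      bound {A} A∈ = ℕ.+-monoʳ-≤ (m + n) (ℕ.≤-trans
        (time-bound I σ̂ T K A (superset-admissible (∈⇒⊆ A∈)))
        (ℕ.*-monoʳ-≤ κ (ℕ.*-mono-≤ (ℕ.*-mono-≤ (∣p∣≤n (jobsOn I σ̂ A)) (∣p∣≤n A)) (begin
          (2 * K + 1) ^ (∣ A ∣ ∸ 1)  ≤⟨ ℕ.^-monoˡ-≤ (∣ A ∣ ∸ 1) (ℕ.+-monoˡ-≤ 1 2K≤N) ⟩
          (N + 1) ^ (∣ A ∣ ∸ 1)      ≤⟨ ℕ.^-monoʳ-≤ (N + 1) ⦃ >-nonZero (ℕ.m≤n+m 1 N) ⦄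
                                          (ℕ.≤-trans (ℕ.m∸n≤m ∣ A ∣ 1) (ℕ.≤-trans (∈⇒size A∈) 2K≤N)) ⟩
          (N + 1) ^ N                ∎))))
        where open ℕ.≤-Reasoning

-- The running time

-- Applied to the source and target of a moved job; m ≥ 2 is what lets constants and `ℰ` be absorbed
-- into powers of `m`.
distinct⇒2≤ : ∀ {m} {i j : Fin m} → i ≢ j → 2 ≤ m
distinct⇒2≤ {1}           {zero} {zero} i≢j = contradiction refl i≢j
distinct⇒2≤ {suc (suc _)} _ = s≤s (s≤s z≤n)

Fin⇒1≤ : ∀ {n} → Fin n → 1 ≤ n
Fin⇒1≤ {suc _} _ = s≤s z≤n

n<m^n : ∀ {m} n → 2 ≤ m → n < m ^ n
n<m^n {m} zero    2≤m = s≤s z≤n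
n<m^n {m} (suc n) 2≤m = begin-strict
  suc n          <⟨ s≤s (n<m^n n 2≤m) ⟩
  1 + m ^ n      ≤⟨ ℕ.+-monoˡ-≤ (m ^ n) (ℕ.≤-trans (s≤s z≤n) (n<m^n n 2≤m)) ⟩
  m ^ n + m ^ n  ≡⟨ cong (m ^ n +_) (ℕ.+-identityʳ (m ^ n)) ⟨
  2 * m ^ n      ≤⟨ ℕ.*-monoˡ-≤ (m ^ n) 2≤m ⟩
  m * m ^ n      ∎
  where open ℕ.≤-Reasoning

^-distribʳ-* : ∀ a b n → (a * b) ^ n ≡ a ^ n * b ^ n
^-distribʳ-* a b zero    = refl
^-distribʳ-* a b (suc n) = trans (cong (a * b *_) (^-distribʳ-* a b n)) (shuffle a b (a ^ n) (b ^ n))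
  where
  shuffle : ∀ a b x y → a * b * (x * y) ≡ a * x * (b * y)
  shuffle = solve-∀

-- Each of the at most ℰ rounds tries at most (1 + m)^(4ℰ) ≤ m^(8ℰ) sets, and
-- (4ℰ + 1)^(4ℰ) ≤ (m³ℰ)^(4ℰ); since m ≥ 2, the remaining factors ℰ and m are
-- absorbed into powers m^ℰ, so no logarithm is needed.
running-time : ∀ n m ℰ κ → 1 ≤ n → 2 ≤ m → 1 ≤ ℰ → (let N = 2 * (2 * ℰ)) →
  ((m + n * (2 + m)) + m) +
    ℰ * ((m + 1) + suc m ^ N * ((m + n) + κ * (n * m * (N + 1) ^ N)))
  ≤ (4 + 2 * (1 + κ)) * (n * m ^ (23 * ℰ) * ℰ ^ (4 * ℰ))
running-time n m ℰ κ 1≤n 2≤m 1≤ℰ = begin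
  ((m + n * (2 + m)) + m) + ℰ * ((m + 1) + suc m ^ N * ((m + n) + κ * (n * m * (N + 1) ^ N)))
    ≤⟨ ℕ.+-mono-≤ setup≤ (ℕ.*-mono-≤ (ℕ.<⇒≤ (n<m^n ℰ 2≤m)) round≤) ⟩
  4 * Q + X * (2 * (1 + κ) * (P * Q))
    ≤⟨ ℕ.+-monoˡ-≤ _ (ℕ.*-monoʳ-≤ 4 (b≤a*b {X * P} {Q} (ℕ.*-mono-≤ 1≤X 1≤P))) ⟩
  4 * (X * P * Q) + X * (2 * (1 + κ) * (P * Q))
    ≡⟨ collect X P Q κ ⟩
  (4 + 2 * (1 + κ)) * (X * P * Q)
    ≤⟨ ℕ.*-monoʳ-≤ (4 + 2 * (1 + κ)) total≤ ⟩
  (4 + 2 * (1 + κ)) * (n * m ^ (23 * ℰ) * ℰ ^ (4 * ℰ)) ∎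
  where
  open ℕ.≤-Reasoning
  N = 2 * (2 * ℰ)
  -- `X` bounds the number of rounds, `P` the number of sets per round, `Y` the exponential factor
  -- of the dynamic program, and `Q`, up to the factor `1 + κ`, the time for one set. One `m` in `Q`
  -- comes from the size of the set; the other absorbs a factor 2.
  X = m ^ ℰ
  P = m ^ (2 * N)
  Y = m ^ (3 * N) * ℰ ^ N
  Q = n * (m * m) * Y

  instance
    m≢0 : NonZero m
    m≢0 = >-nonZero (ℕ.≤-trans (s≤s z≤n) 2≤m)
    ℰ≢0 : NonZero ℰ
    ℰ≢0 = >-nonZero 1≤ℰ

  1≤m : 1 ≤ m
  1≤m = ℕ.≤-trans (s≤s z≤n) 2≤m

  1≤X : 1 ≤ X
  1≤X = ℕ.m^n>0 m ℰ

  1≤P : 1 ≤ P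
  1≤P = ℕ.m^n>0 m (2 * N)

  1≤Y : 1 ≤ Y
  1≤Y = ℕ.*-mono-≤ (ℕ.m^n>0 m (3 * N)) (ℕ.m^n>0 ℰ N)

  b≤a*b : ∀ {a b} → 1 ≤ a → b ≤ a * b
  b≤a*b {a} {b} 1≤a = ℕ.≤-trans (ℕ.≤-reflexive (sym (ℕ.*-identityˡ b))) (ℕ.*-monoˡ-≤ b 1≤a)

  a≤a*b : ∀ {a b} → 1 ≤ b → a ≤ a * b
  a≤a*b {a} {b} 1≤b = ℕ.≤-trans (b≤a*b {b} {a} 1≤b) (ℕ.≤-reflexive (ℕ.*-comm b a))

  collect : ∀ X P Q κ → 4 * (X * P * Q) + X * (2 * (1 + κ) * (P * Q)) ≡ (4 + 2 * (1 + κ)) * (X * P * Q)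
  collect = solve-∀

  2nm≤Q : 2 * (n * m) ≤ Q
  2nm≤Q = begin
    2 * (n * m)      ≤⟨ ℕ.*-monoˡ-≤ (n * m) 2≤m ⟩
    m * (n * m)      ≡⟨ shuffle m n ⟩
    n * (m * m)      ≤⟨ a≤a*b 1≤Y ⟩
    Q                ∎
    where
    shuffle : ∀ m n → m * (n * m) ≡ n * (m * m)
    shuffle = solve-∀

  m+n≤Q : m + n ≤ Q
  m+n≤Q = ℕ.≤-trans (ℕ.+-mono-≤ (b≤a*b 1≤n)
    (ℕ.≤-trans (a≤a*b 1≤m) (ℕ.≤-reflexive (sym (ℕ.+-identityʳ _))))) 2nm≤Q

  setup≤ : (m + n * (2 + m)) + m ≤ 4 * Q
  setup≤ = begin
    (m + n * (2 + m)) + m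
      ≤⟨ ℕ.+-mono-≤ (ℕ.+-mono-≤ (b≤a*b {n} {m} 1≤n) (ℕ.*-monoʳ-≤ n (ℕ.+-monoˡ-≤ m 2≤m)))
           (b≤a*b {n} {m} 1≤n) ⟩
    (n * m + n * (m + m)) + n * m
      ≡⟨ shuffle n m ⟩
    2 * (2 * (n * m))
      ≤⟨ ℕ.*-mono-≤ (ℕ.m≤m+n 2 2) 2nm≤Q ⟩
    4 * Q ∎
    where
    shuffle : ∀ n m → (n * m + n * (m + m)) + n * m ≡ 2 * (2 * (n * m))
    shuffle = solve-∀

  base≤ : N + 1 ≤ m ^ 3 * ℰ
  base≤ = begin
    -- The 1 is enlarged to 4ℰ, giving 8ℰ in total, and 8 is at most m³.
    N + 1          ≤⟨ ℕ.+-monoʳ-≤ N (ℕ.≤-trans 1≤ℰ (ℕ.m≤m+n ℰ (3 * ℰ))) ⟩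
    N + 4 * ℰ      ≡⟨ shuffle ℰ ⟩
    2 ^ 3 * ℰ      ≤⟨ ℕ.*-monoˡ-≤ ℰ (ℕ.^-monoˡ-≤ 3 2≤m) ⟩
    m ^ 3 * ℰ      ∎
    where
    shuffle : ∀ e → 2 * (2 * e) + 4 * e ≡ 8 * e
    shuffle = solve-∀

  power≤ : (N + 1) ^ N ≤ Y
  power≤ = begin
    (N + 1) ^ N            ≤⟨ ℕ.^-monoˡ-≤ N base≤ ⟩
    (m ^ 3 * ℰ) ^ N        ≡⟨ ^-distribʳ-* (m ^ 3) ℰ N ⟩
    (m ^ 3) ^ N * ℰ ^ N    ≡⟨ cong (_* ℰ ^ N) (ℕ.^-*-assoc m 3 N) ⟩
    Y                      ∎

  sets≤ : suc m ^ N ≤ P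
  sets≤ = begin
    -- Here 1 + m ≤ 2m ≤ m².
    suc m ^ N        ≤⟨ ℕ.^-monoˡ-≤ N (ℕ.≤-trans (ℕ.+-mono-≤ 1≤m (ℕ.≤-reflexive (sym (ℕ.*-identityʳ m))))
                          (ℕ.≤-trans (ℕ.≤-reflexive (shuffle m)) (ℕ.*-monoˡ-≤ (m * 1) 2≤m))) ⟩
    (m ^ 2) ^ N      ≡⟨ ℕ.^-*-assoc m 2 N ⟩
    P                ∎
    where
    shuffle : ∀ m → m + m * 1 ≡ 2 * (m * 1)
    shuffle = solve-∀

  set≤ : (m + n) + κ * (n * m * (N + 1) ^ N) ≤ (1 + κ) * Q
  set≤ = ℕ.+-mono-≤ m+n≤Q (ℕ.*-monoʳ-≤ κ
    (ℕ.*-mono-≤ (ℕ.*-monoʳ-≤ n (a≤a*b 1≤m)) power≤))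

  round≤ : (m + 1) + suc m ^ N * ((m + n) + κ * (n * m * (N + 1) ^ N)) ≤ 2 * (1 + κ) * (P * Q)
  round≤ = begin
    (m + 1) + suc m ^ N * ((m + n) + κ * (n * m * (N + 1) ^ N))
      ≤⟨ ℕ.+-mono-≤ (ℕ.≤-trans (ℕ.+-monoʳ-≤ m 1≤n) (ℕ.≤-trans m+n≤Q
           (ℕ.≤-trans (b≤a*b 1≤P) (b≤a*b {1 + κ} (s≤s z≤n)))))
         (ℕ.*-mono-≤ sets≤ set≤) ⟩
    (1 + κ) * (P * Q) + P * ((1 + κ) * Q)
      ≡⟨ shuffle P Q κ ⟩
    2 * (1 + κ) * (P * Q) ∎
    where
    shuffle : ∀ P Q κ → (1 + κ) * (P * Q) + P * ((1 + κ) * Q) ≡ 2 * (1 + κ) * (P * Q)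
    shuffle = solve-∀

  total≤ : X * P * Q ≤ n * m ^ (23 * ℰ) * ℰ ^ (4 * ℰ)
  total≤ = begin
    X * P * Q
      ≡⟨ shuffle X P n m (m ^ (3 * N)) (ℰ ^ N) ⟩
    n * (X * (P * (m ^ 2 * m ^ (3 * N)))) * ℰ ^ N
      ≡⟨ cong (λ x → n * x * ℰ ^ N) powers ⟩
    n * m ^ (ℰ + (2 * N + (2 + 3 * N))) * ℰ ^ N
      ≤⟨ ℕ.*-mono-≤ (ℕ.*-monoʳ-≤ n (ℕ.^-monoʳ-≤ m exponent≤)) (ℕ.≤-reflexive (cong (ℰ ^_) (N≡ ℰ))) ⟩
    n * m ^ (23 * ℰ) * ℰ ^ (4 * ℰ) ∎
    where
    shuffle : ∀ X P n m U V → X * P * (n * (m * m) * (U * V)) ≡ n * (X * (P * (m * (m * 1) * U))) * V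
    shuffle = solve-∀
    powers : X * (P * (m ^ 2 * m ^ (3 * N))) ≡ m ^ (ℰ + (2 * N + (2 + 3 * N)))
    powers = sym (trans (ℕ.^-distribˡ-+-* m ℰ _) (cong (X *_)
      (trans (ℕ.^-distribˡ-+-* m (2 * N) _) (cong (P *_) (ℕ.^-distribˡ-+-* m 2 (3 * N))))))
    N≡ : ∀ e → 2 * (2 * e) ≡ 4 * e
    N≡ = solve-∀
    -- With N = 4ℰ and the constant 2 raised to 2ℰ, the exponent of `m` is (1 + 8 + 2 + 12)ℰ.
    exponents : ∀ e → e + (2 * (2 * (2 * e)) + (2 * e + 3 * (2 * (2 * e)))) ≡ 23 * e
    exponents = solve-∀
    exponent≤ : ℰ + (2 * N + (2 + 3 * N)) ≤ 23 * ℰ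
    exponent≤ = ℕ.≤-trans
      (ℕ.+-monoʳ-≤ ℰ (ℕ.+-monoʳ-≤ (2 * N) (ℕ.+-monoˡ-≤ (3 * N) (ℕ.*-monoʳ-≤ 2 1≤ℰ))))
      (ℕ.≤-reflexive (exponents ℰ))

-- Correctness and total running time of the repair

corollary17 : (dp : FixedSetProcedure) →
    ∃[ C ] ∃[ a ] ∃[ b ] ∃[ d ]
    (∀ {n m : ℕ} (I : Instance n m) (ch : Choices I)
    (π̂ : Schedule n m) (T : ℚ) {opt ℰ : ℕ} →
    IsOPT I opt →
    IsError I π̂ ℰ →
    toℚ opt ℚ.≤ T →
    0ℚ ℚ.< Δ I (result (project I ch π̂)) T →
    ∃[ σ ] ∃[ t ]
    (GlobalRepair I ch dp T π̂ (σ costs t) ×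
    Feasible I σ ×
    toℚ (Cmax I σ) ℚ.≤ T ×
    (let f = n * m ^ (a * ℰ) * ℰ ^ (b * ℰ)
    in t ≤ C * (f * (1 + ⌊log₂ f ⌋) ^ d))))
-- The constants are those of `running-time`. The logarithmic exponent is 0, so the logarithmic
-- factor reduces to the trailing `* 1` below.
corollary17 dp = 4 + 2 * (1 + κ) , 23 , 4 , 0 , repair
  where
  open FixedSetProcedure dp
  repair : ∀ {n m : ℕ} (I : Instance n m) (ch : Choices I) (π̂ : Schedule n m) (T : ℚ) {opt ℰ : ℕ} →
    IsOPT I opt → IsError I π̂ ℰ → toℚ opt ℚ.≤ T → 0ℚ ℚ.< Δ I (result (project I ch π̂)) T →
    ∃[ σ ] ∃[ t ] (GlobalRepair I ch dp T π̂ (σ costs t) × Feasible I σ × toℚ (Cmax I σ) ℚ.≤ T ×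
      t ≤ (4 + 2 * (1 + κ)) * (n * m ^ (23 * ℰ) * ℰ ^ (4 * ℰ) * 1))
  repair {n} {m} I ch π̂ T {opt} {ℰ} ((τ₀ , τ₀-feasible , Cmax-τ₀) , _)
         ((σ* , (σ*-feasible , _ , opt-min) , move-σ*) , _) opt≤T 0<Δ
    = σ , total , run-GlobalRepair , IsRepair.feasible (proj₂ (proj₂ isRepair)) ,
      IsRepair.Cmax≤T (proj₂ (proj₂ isRepair)) , total≤
    where
    σ̂ = result (project I ch π̂)
    K₀ = ℤ.∣ ℚ.ceiling (Δ I σ̂ T) ∣

    σ̂-feasible : Feasible I σ̂
    σ̂-feasible = project-feasible I ch π̂

    Cmax-σ*≤T : toℚ (Cmax I σ*) ℚ.≤ T
    -- `opt` is attained by `τ₀`, and the makespan of `σ*` is minimal among feasible schedules.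
    Cmax-σ*≤T = ℚ.≤-trans
      (toℚ-mono {Cmax I σ*} {opt} (ℕ.≤-trans (opt-min τ₀ τ₀-feasible) (ℕ.≤-reflexive Cmax-τ₀)))
      opt≤T

    move≤ℰ : move I σ* σ̂ ≤ ℰ
    move≤ℰ = ℕ.≤-trans (move-project≤ I ch σ* π̂ σ*-feasible) (ℕ.≤-reflexive move-σ*)

    K₀-bounds : 1 ≤ K₀ × K₀ ≤ ℰ
    K₀-bounds = ∣ceiling∣-bounds (Δ I σ̂ T) ℰ 0<Δ
      (ℚ.≤-trans (Δ≤move I {σ*} Cmax-σ*≤T σ̂) (toℚ-mono {move I σ* σ̂} {ℰ} move≤ℰ))

    overload : Nonempty (overloaded I σ̂ T)
    overload = Δ-positive I σ̂ T 0<Δ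

    A* = touched I σ* σ̂

    O⊆A* : overloaded I σ̂ T ⊆ A*
    O⊆A* i∈ = let (j , σ̂j≡i , moved) = overloaded⇒moved I {σ*} Cmax-σ*≤T σ̂ i∈
              in subst (_∈ A*) σ̂j≡i (proj₁ (moved⇒touched I σ* σ̂ j moved))

    -- A job leaving an overloaded machine witnesses both n ≥ 1 and, through its two distinct
    -- machines, m ≥ 2.
    some-moved : ∃[ j ] σ̂ j ≡ proj₁ overload × σ* j ≢ σ̂ j
    some-moved = overloaded⇒moved I {σ*} Cmax-σ*≤T σ̂ (proj₂ overload)

    fails⇒< : ∀ K → 1 ≤ K → result (globalRepairOracle I ch dp T σ̂ K) ≡ nothing → K < ℰ
    -- For K ≥ ℰ the set `A*` fits the size limit 2K and `σ*` fits the move budget, so the oracle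
    -- cannot fail.
    fails⇒< K 1≤K failed = ℕ.≰⇒> λ ℰ≤K →
      oracle-complete I ch dp T σ̂ K σ̂-feasible 1≤K overload O⊆A*
        (ℕ.≤-trans (∣touched∣≤2*move I σ* σ̂) (ℕ.*-monoʳ-≤ 2 (ℕ.≤-trans move≤ℰ ℰ≤K)))
        (touched-repair I {σ*} {σ̂} σ*-feasible Cmax-σ*≤T (ℕ.≤-trans move≤ℰ ℰ≤K))
        failed

    1≤ℰ : 1 ≤ ℰ
    1≤ℰ = ℕ.≤-trans (proj₁ K₀-bounds) (proj₂ K₀-bounds)

    B = let N = 2 * (2 * ℰ) in
        (m + 1) + suc m ^ N * ((m + n) + κ * (n * m * (N + 1) ^ N))

    terminates : ∃[ σ ] ∃[ t ] Doubling (globalRepairOracle I ch dp T σ̂) K₀ (σ costs t) ×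
      t ≤ ℰ * B × ∃[ K ] (1 ≤ K × result (globalRepairOracle I ch dp T σ̂ K) ≡ just σ)
    terminates = doubling-terminates (globalRepairOracle I ch dp T σ̂) {B} ℰ fails⇒<
      -- From K ≤ 2ℰ the size limit 2K is at most 4ℰ, the value of `N` in `B`.
      (λ K 1≤K K≤2ℰ → oracle-time I ch dp T σ̂ K σ̂-feasible 1≤K overload (ℕ.*-monoʳ-≤ 2 K≤2ℰ))
      K₀ (proj₁ K₀-bounds) (proj₂ K₀-bounds)

    σ = proj₁ terminates
    t = proj₁ (proj₂ terminates)

    loop : Doubling (globalRepairOracle I ch dp T σ̂) K₀ (σ costs t)
    loop = proj₁ (proj₂ (proj₂ terminates))

    t≤ : t ≤ ℰ * B
    t≤ = proj₁ (proj₂ (proj₂ (proj₂ terminates)))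

    isRepair : ∃[ A ] ∃[ K ] IsRepair I σ̂ T K A σ
    isRepair =
      let (K , 1≤K , found) = proj₂ (proj₂ (proj₂ (proj₂ terminates)))
          (A , r) = oracle-sound I ch dp T σ̂ K σ̂-feasible 1≤K overload found
      in A , K , r

    total : ℕ
    total = time (project I ch π̂) + m + t

    run-GlobalRepair : GlobalRepair I ch dp T π̂ (σ costs total)
    run-GlobalRepair = repaired refl (λ Δ≡0 → ℚ.<-irrefl (sym Δ≡0) 0<Δ) loop

    total≤ : total ≤ (4 + 2 * (1 + κ)) * (n * m ^ (23 * ℰ) * ℰ ^ (4 * ℰ) * 1)
    total≤ = begin
      total
        ≤⟨ ℕ.+-mono-≤ (ℕ.+-monoˡ-≤ m (project-time I ch π̂)) t≤ ⟩
      ((m + n * (2 + m)) + m) + ℰ * B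
        ≤⟨ running-time n m ℰ κ (Fin⇒1≤ (proj₁ some-moved))
             (distinct⇒2≤ (proj₂ (proj₂ some-moved))) 1≤ℰ ⟩
      (4 + 2 * (1 + κ)) * (n * m ^ (23 * ℰ) * ℰ ^ (4 * ℰ))
        ≡⟨ cong ((4 + 2 * (1 + κ)) *_) (ℕ.*-identityʳ (n * m ^ (23 * ℰ) * ℰ ^ (4 * ℰ))) ⟨
      (4 + 2 * (1 + κ)) * (n * m ^ (23 * ℰ) * ℰ ^ (4 * ℰ) * 1) ∎
      where open ℕ.≤-Reasoning
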